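{- The LP relaxation of ($k$-tier-IP) has an integrality gap of at least $2k(1-1/|V|)$. That is, for all integers $k\ge1$ and $n\ge 2$ there is an instance of $k$-tier FGC on a graph with $|V|=n$ vertices for which the optimum value of ($k$-tier-IP) is at least $2k(1-1/n)$ times the optimum value of its LP relaxation.
   Context: An instance of $k$-tier FGC consists of an undirected graph $G=(V,E)$, edge costs $c:E\to\mathbb{R}_{\ge0}$, edge-tiers $T_1\subseteq\cdots\subseteq T_k=E$, and integers $0\le q_1\le\cdots\le q_k$. Notation: $[k]=\{1,\ldots,k\}$; $\delta(R)$ is the set of edges with exactly one end vertex in $R$; $\delta_{T_i}(R):=\delta(R)\cap T_i$; $a^+:=\max\{a,0\}$; $x(A):=\sum_{e\in A}x_e$. The integer program ($k$-tier-IP) is: minimize $\sum_{e\in E}c_ex_e$ subject to $$\sum_{i=1}^k\Bigl(\prod_{j\in[k]\setminus\{i\}}(q_j-|J\cap T_j|)^+\Bigr)x(\delta_{T_i}(R)\setminus J)\ \ge\ \prod_{i=1}^k(q_i-|J\cap T_i|)^+$$ for all pairs $(J,R)$ with $\emptyset\ne R\subsetneq V$ and $J\subseteq\delta(R)$, together with $0\le x_e\le1$ and $x_e\in\mathbb{Z}$ for all $e\in E$. Its LP relaxation drops the integrality constraints $x_e\in\mathbb{Z}$. -}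

module Defs where

open import Algebra.Bundles using (CommutativeRing)
import Algebra.Definitions.RawMonoid as RawMonoidDefinitions
open import Data.Bool using (if_then_else_; _xor_)
open import Data.Fin as Fin using (Fin; toℕ)
open import Data.Fin.Subset using (Subset; ⊤; _∈_; _⊆_; _⊂_; _∩_; _─_; ∣_∣; Nonempty)
open import Data.Integer using (ℤ; +_; -[1+_])
open import Data.Nat as ℕ using (ℕ; suc; _∸_)
import Data.Nat.Properties as ℕ
open import Data.Product using (_×_; _,_; proj₁; proj₂; ∃-syntax)
open import Data.Vec using (lookup; tabulate)
open import Data.Vec.Functional using (Vector)
open import Function.Definitions using (Injective)
open import Level using (_⊔_; 0ℓ) renaming (suc to lsuc)
open import Relation.Binary.Core using (Rel)
open import Relation.Binary.Structures using (IsTotalOrder)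
open import Relation.Binary.PropositionalEquality using (_≡_)
open import Relation.Nullary using (¬_; does; yes; no; contradiction)
import Relation.Binary.Construct.NonStrictToStrict as NonStrictToStrict
import Data.Rational as ℚ
import Data.Rational.Properties as ℚ

------------------------------------------------------------------------
-- Scalars

-- agda-stdlib has no real numbers, so costs and LP variables range over an
-- arbitrary ordered field, of which ℝ is an instance.  The inverse is a total
-- function, with an arbitrary value at 0.
record OrderedField c ℓ₁ ℓ₂ : Set (lsuc (c ⊔ ℓ₁ ⊔ ℓ₂)) where
  infix 4 _≤_
  infix 8 _⁻¹
  field
    commutativeRing : CommutativeRing c ℓ₁
  open CommutativeRing commutativeRing public
  field
    _≤_          : Rel Carrier ℓ₂
    isTotalOrder : IsTotalOrder _≈_ _≤_
    +-monoʳ-≤    : ∀ x {y z} → y ≤ z → x + y ≤ x + z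
    *-nonNeg     : ∀ {x y} → 0# ≤ x → 0# ≤ y → 0# ≤ x * y
    0≉1          : ¬ 0# ≈ 1#
    _⁻¹          : Carrier → Carrier
    *-inverseʳ   : ∀ {x} → ¬ x ≈ 0# → x * x ⁻¹ ≈ 1#

  open NonStrictToStrict _≈_ _≤_ public using (_<_)

  -- a · x is the a-fold sum x + ⋯ + x.
  open RawMonoidDefinitions +-rawMonoid public using (sum) renaming (_×_ to _·_)

  fromℕ : ℕ → Carrier
  fromℕ a = a · 1#

  fromℤ : ℤ → Carrier
  fromℤ (+ a)    = fromℕ a
  fromℤ -[1+ a ] = - fromℕ (suc a)

ℚ-orderedField : OrderedField 0ℓ 0ℓ 0ℓ
ℚ-orderedField = record
  { commutativeRing = ℚ.+-*-commutativeRing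
  ; _≤_             = ℚ._≤_
  ; isTotalOrder    = ℚ.≤-isTotalOrder
  ; +-monoʳ-≤       = λ x → ℚ.+-monoʳ-≤ x
  ; *-nonNeg        = λ {x} {y} 0≤x 0≤y →
      let instance
            nx = ℚ.nonNegative 0≤x
            ny = ℚ.nonNegative 0≤y
      in ℚ.nonNegative⁻¹ (x ℚ.* y) {{ℚ.nonNeg*nonNeg⇒nonNeg x y}}
  ; 0≉1             = λ ()
  ; _⁻¹             = inv
  ; *-inverseʳ      = λ {x} → inv-inverseʳ x
  }
  where
  inv : ℚ.ℚ → ℚ.ℚ
  inv x with x ℚ.≟ ℚ.0ℚ
  ... | yes _   = ℚ.0ℚ
  ... | no  x≢0 = ℚ.1/_ x {{ℚ.≢-nonZero x≢0}}

  inv-inverseʳ : ∀ x → ¬ x ≡ ℚ.0ℚ → x ℚ.* inv x ≡ ℚ.1ℚ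
  inv-inverseʳ x x≢0 with x ℚ.≟ ℚ.0ℚ
  ... | yes x≡0 = contradiction x≡0 x≢0
  ... | no  x≢0 = ℚ.*-inverseʳ x {{ℚ.≢-nonZero x≢0}}

------------------------------------------------------------------------
-- Graphs

-- A finite simple graph on the vertex set Fin n with edge set Fin m.  An edge
-- is listed by its smaller and its larger end vertex, which rules out loops,
-- and injectivity of the listing rules out parallel edges.
record Graph (n : ℕ) : Set where
  field
    m        : ℕ
    ends     : Fin m → Fin n × Fin n
    ordered  : ∀ e → proj₁ (ends e) Fin.< proj₂ (ends e)
    distinct : Injective _≡_ _≡_ ends

  δ : Subset n → Subset m
  δ R = tabulate λ e → lookup R (proj₁ (ends e)) xor lookup R (proj₂ (ends e))

------------------------------------------------------------------------
-- k-tier FGC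

module _ {c ℓ₁ ℓ₂} (F : OrderedField c ℓ₁ ℓ₂) where
  open OrderedField F using (Carrier; _≈_; _≤_; _*_; 0#; 1#; _·_; sum; fromℕ; fromℤ)

  -- Tiers are indexed from 0, so that T i and q i are T_{i+1} and q_{i+1}.
  record Instance (k n : ℕ) : Set (c ⊔ ℓ₂) where
    field
      graph : Graph n
    open Graph graph public
    field
      cost        : Vector Carrier m
      cost-nonNeg : ∀ e → 0# ≤ cost e
      T           : Fin k → Subset m
      T-mono      : ∀ {i j} → i Fin.≤ j → T i ⊆ T j
      T-last      : ∀ i → suc (toℕ i) ≡ k → T i ≡ ⊤
      q           : Fin k → ℕ
      q-mono      : ∀ {i j} → i Fin.≤ j → q i ℕ.≤ q j

  module _ {k n : ℕ} (I : Instance k n) where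
    open Instance I
    open RawMonoidDefinitions ℕ.*-1-rawMonoid using () renaming (sum to product)

    -- x(A)
    weight : Vector Carrier m → Subset m → Carrier
    weight x A = sum λ e → if lookup A e then x e else 0#

    -- (q_j − |J ∩ T_j|)⁺; truncated subtraction is the positive part.
    residual : Subset m → Fin k → ℕ
    residual J j = q j ∸ ∣ J ∩ T j ∣

    coefficient : Subset m → Fin k → ℕ
    coefficient J i = product λ j → if does (j Fin.≟ i) then 1 else residual J j

    CutConstraint : Vector Carrier m → Subset m → Subset n → Set ℓ₂
    CutConstraint x J R =
      fromℕ (product (residual J))
        ≤ sum λ i → coefficient J i · weight x ((δ R ∩ T i) ─ J)

    LPFeasible : Vector Carrier m → Set ℓ₂
    LPFeasible x =
      (∀ J R → Nonempty R → R ⊂ ⊤ → J ⊆ δ R → CutConstraint x J R) ×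
      (∀ e → 0# ≤ x e × x e ≤ 1#)

    IPFeasible : Vector Carrier m → Set (ℓ₁ ⊔ ℓ₂)
    IPFeasible x = LPFeasible x × (∀ e → ∃[ z ] x e ≈ fromℤ z)

    totalCost : Vector Carrier m → Carrier
    totalCost x = sum λ e → cost e * x e

    IsOptimum : ∀ {ℓ} → (Vector Carrier m → Set ℓ) → Carrier → Set (c ⊔ ℓ₁ ⊔ ℓ₂ ⊔ ℓ)
    IsOptimum Feasible v =
      (∃[ x ] Feasible x × totalCost x ≈ v) ×
      (∀ x → Feasible x → v ≤ totalCost x)

    IsOptimumIP : Carrier → Set (c ⊔ ℓ₁ ⊔ ℓ₂)
    IsOptimumIP = IsOptimum IPFeasible

    IsOptimumLP : Carrier → Set (c ⊔ ℓ₁ ⊔ ℓ₂)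
    IsOptimumLP = IsOptimum LPFeasible

{-# OPTIONS --safe #-}

-- The gap is attained with every tier equal to E, every q_i equal to 1 and unit
-- costs, on the cycle with n vertices (a single edge if n = 2).  Only J = ∅ then
-- gives a nontrivial constraint, namely k x(δ(R)) ≥ 1.  With h = 1/(2k), the
-- constant point h (2h if n = 2) is feasible since every cut of the cycle has two
-- edges, and it is optimal, of value n h, by summing the constraints of the single
-- vertices.  An integral point vanishes on at most one edge, since any two edges
-- form a cut, so the integral optimum is n − 1.
module Submission where

open import Defs
open import Data.Nat as ℕ using (ℕ)
open import Data.Product using (_×_; Σ-syntax)

open import Algebra.Bundles using (CommutativeMonoid; CommutativeRing)
import Algebra.Properties.AbelianGroup as AbelianGroupProperties
import Algebra.Properties.CommutativeMonoid.Mult as CommutativeMonoidMult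
import Algebra.Properties.CommutativeSemigroup as CommutativeSemigroupProperties
import Algebra.Properties.Monoid.Sum as MonoidSum
import Algebra.Properties.Ring as RingProperties
import Algebra.Properties.Semiring.Mult as SemiringMult
import Algebra.Properties.Semiring.Sum as SemiringSum
open import Data.Bool using (Bool; true; false; if_then_else_; _xor_)
import Data.Bool.Properties as Bool
open import Data.Fin as Fin using (Fin; zero; suc; inject₁)
import Data.Fin.Properties as Fin
open import Data.Fin.Subset using (Subset; ⊤; ⊥; _∈_; _∉_; _⊂_; _∩_; _─_; ∣_∣; Nonempty)
import Data.Fin.Subset.Properties as Subset
open import Data.Integer using (+_; -[1+_])
open import Data.Nat using (zero; suc; s≤s)
import Data.Nat.Properties as ℕ
open import Data.Product using (_,_; proj₁; proj₂; ∃-syntax)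
open import Data.Sum using (_⊎_; inj₁; inj₂)
open import Data.Vec using (lookup; tabulate)
open import Data.Vec.Functional using (Vector; replicate; tail)
import Data.Vec.Properties as Vec
open import Function using (_∘_)
open import Level using (_⊔_)
open import Relation.Binary.Bundles using (Poset)
open import Relation.Binary.PropositionalEquality as ≡ using (_≡_; _≢_)
import Relation.Binary.Reasoning.PartialOrder as PosetReasoning
open import Relation.Binary.Structures using (IsTotalOrder)
open import Relation.Nullary using (¬_; does; yes; no; contradiction)

-- Boolean labellings of the vertices.

xor-interchange : ∀ a b c d → (a xor b) xor (c xor d) ≡ (a xor c) xor (b xor d)
xor-interchange = CommutativeSemigroupProperties.interchange
  (CommutativeMonoid.commutativeSemigroup
    (CommutativeRing.+-commutativeMonoid Bool.xor-∧-commutativeRing))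

xor-telescope : ∀ a b c → (a xor b) xor (b xor c) ≡ a xor c
xor-telescope false false c = ≡.refl
xor-telescope false true  c = Bool.not-involutive c
xor-telescope true  false c = ≡.refl
xor-telescope true  true  c = ≡.refl

separated : ∀ a b c → b xor c ≡ true → a xor b ≡ true ⊎ a xor c ≡ true
separated false true  false _ = inj₁ ≡.refl
separated false false true  _ = inj₂ ≡.refl
separated true  true  false _ = inj₂ ≡.refl
separated true  false true  _ = inj₁ ≡.refl

-- A labelling stands for a vertex set `R`; this says that `R` and its complement are both nonempty.
-- It is symmetric under complement, so `u` need not be the vertex inside.
NonConstant : ∀ {n} → (Fin n → Bool) → Set
NonConstant r = ∃[ u ] ∃[ v ] r u xor r v ≡ true

nonConstant-from : ∀ {n} (r : Fin n → Bool) z → NonConstant r → ∃[ v ] r z xor r v ≡ true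
nonConstant-from r z (u , v , uv) with separated (r z) (r u) (r v) uv
... | inj₁ zu = u , zu
... | inj₂ zv = v , zv

oriented : ∀ {n} (r : Fin n → Bool) → NonConstant r → ∃[ u ] ∃[ v ] r u ≡ true × r v ≡ false
oriented r (u , v , uv) with r u in ru | r v in rv
... | true  | false = u , v , ru , rv
... | false | true  = v , u , rv , ru

singleton : ∀ {n} → Fin n → Fin n → Bool
singleton v u = does (v Fin.≟ u)

singleton-nonConstant : ∀ {n} (v : Fin (suc (suc n))) → NonConstant (singleton v)
singleton-nonConstant zero    = zero , suc zero , ≡.refl
singleton-nonConstant (suc v) = zero , suc v , ≡.cong does (≡.≡-≟-identity Fin._≟_ {x = v} ≡.refl)

-- The single edge, the cycle, and the vertex sets that cut them.

crosses : ∀ {n} (G : Graph n) → (Fin n → Bool) → Fin (Graph.m G) → Bool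
crosses G r e = r (proj₁ (Graph.ends G e)) xor r (proj₂ (Graph.ends G e))

lookup-δ : ∀ {n} (G : Graph n) R e → lookup (Graph.δ G R) e ≡ crosses G (lookup R) e
lookup-δ G R e = Vec.lookup∘tabulate (crosses G (lookup R)) e

edge : Graph 2
edge = record
  { m        = 1
  ; ends     = λ _ → zero , suc zero
  ; ordered  = λ _ → s≤s ℕ.z≤n
  ; distinct = λ { {zero} {zero} _ → ≡.refl }
  }

-- Edge 0 closes the path whose i-th edge is edge i + 1.
cycleEnds : ∀ {N} → Fin (suc N) → Fin (suc N) × Fin (suc N)
cycleEnds {N} zero    = zero , Fin.fromℕ N
cycleEnds     (suc i) = inject₁ i , suc i

cycle : ∀ p → Graph (suc (suc (suc p)))
cycle p = record
  { m        = suc (suc (suc p))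
  ; ends     = cycleEnds
  ; ordered  = λ { zero    → s≤s ℕ.z≤n
                 ; (suc i) → s≤s (ℕ.≤-reflexive (Fin.toℕ-inject₁ i)) }
  ; distinct = distinct
  }
  where
  closing≢path : ∀ i → cycleEnds zero ≢ cycleEnds {suc (suc p)} (suc i)
  -- This path edge also starts at vertex 0; its other end is vertex 1, which is not the last vertex
  -- because there are at least three.
  closing≢path zero    ()
  closing≢path (suc i) ()

  distinct : ∀ {e f} → cycleEnds {suc (suc p)} e ≡ cycleEnds f → e ≡ f
  distinct {zero}  {zero}  _  = ≡.refl
  distinct {zero}  {suc j} eq = contradiction eq (closing≢path j)
  distinct {suc i} {zero}  eq = contradiction (≡.sym eq) (closing≢path i)
  distinct {suc i} {suc j} eq = ≡.cong proj₂ eq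

-- The characteristic function of {0, …, a}, whose only crossing path edge is a.
initial : ∀ {N} → Fin N → Fin (suc N) → Bool
initial a       zero    = true
initial zero    (suc v) = false
initial (suc a) (suc v) = initial a v

initial-last : ∀ {N} (a : Fin N) → initial a (Fin.fromℕ N) ≡ false
initial-last zero    = ≡.refl
initial-last (suc a) = initial-last a

initial-suc : ∀ {N} (a : Fin N) → initial a (suc a) ≡ false
initial-suc zero    = ≡.refl
initial-suc (suc a) = initial-suc a

initial-< : ∀ {N} {a b : Fin N} → a Fin.< b → initial b (suc a) ≡ true
initial-< {a = zero}  {suc b} _         = ≡.refl
initial-< {a = suc a} {suc b} (s≤s a<b) = initial-< a<b

module _ {c ℓ₁ ℓ₂} (F : OrderedField c ℓ₁ ℓ₂) where
  open OrderedField F hiding (zero)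
  open AbelianGroupProperties +-abelianGroup using (⁻¹-involutive)
  open RingProperties ring using (-‿distribˡ-*)
  open CommutativeMonoidMult +-commutativeMonoid using (×-distrib-+)
  open SemiringMult semiring using (×-congʳ; ×-homo-+; ×-comm-*; ×-assoc-*)
  open SemiringSum semiring
    using (sum-cong-≋; sum-replicate; sum-replicate-zero; ∑-distrib-+; ∑-comm)
  open CommutativeSemigroupProperties *-commutativeSemigroup using ()
    renaming (interchange to *-interchange)

  private
    poset : Poset _ _ _
    poset = record { isPartialOrder = IsTotalOrder.isPartialOrder isTotalOrder }
    module ≤ = IsTotalOrder isTotalOrder
    open PosetReasoning poset

  -- Arithmetic in an ordered field.

  +-mono-≤ : ∀ {a b x y} → a ≤ b → x ≤ y → a + x ≤ b + y
  +-mono-≤ {a} {b} {x} {y} a≤b x≤y = begin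
    a + x ≤⟨ +-monoʳ-≤ a x≤y ⟩
    a + y ≈⟨ +-comm a y ⟩
    y + a ≤⟨ +-monoʳ-≤ y a≤b ⟩
    y + b ≈⟨ +-comm y b ⟩
    b + y ∎

  +-nonNeg : ∀ {x y} → 0# ≤ x → 0# ≤ y → 0# ≤ x + y
  +-nonNeg {x} {y} 0≤x 0≤y = begin
    0#      ≈⟨ +-identityʳ 0# ⟨
    0# + 0# ≤⟨ +-mono-≤ 0≤x 0≤y ⟩
    x + y   ∎

  x≤x+y : ∀ {x y} → 0# ≤ y → x ≤ x + y
  x≤x+y {x} {y} 0≤y = begin
    x      ≈⟨ +-identityʳ x ⟨
    x + 0# ≤⟨ +-monoʳ-≤ x 0≤y ⟩
    x + y  ∎

  x≤y+x : ∀ {x y} → 0# ≤ y → x ≤ y + x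
  x≤y+x {x} {y} 0≤y = ≤.trans (x≤x+y 0≤y) (≤.reflexive (+-comm x y))

  -x+[x+y]≈y : ∀ x y → - x + (x + y) ≈ y
  -x+[x+y]≈y x y = begin-equality
    - x + (x + y) ≈⟨ +-assoc (- x) x y ⟨
    (- x + x) + y ≈⟨ +-congʳ (-‿inverseˡ x) ⟩
    0# + y        ≈⟨ +-identityˡ y ⟩
    y             ∎

  +-cancelˡ-≤ : ∀ x {y z} → x + y ≤ x + z → y ≤ z
  +-cancelˡ-≤ x {y} {z} le = begin
    y             ≈⟨ -x+[x+y]≈y x y ⟨
    - x + (x + y) ≤⟨ +-monoʳ-≤ (- x) le ⟩
    - x + (x + z) ≈⟨ -x+[x+y]≈y x z ⟩
    z             ∎

  -- If `y ≤ x` then `x + x ≤ y + y ≤ x + y`, and `x` cancels. This halves the handshake identity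
  -- without a division.
  x+x≤y+y⇒x≤y : ∀ {x y} → x + x ≤ y + y → x ≤ y
  x+x≤y+y⇒x≤y {x} {y} le with ≤.total x y
  ... | inj₁ x≤y = x≤y
  ... | inj₂ y≤x = +-cancelˡ-≤ x (≤.trans le (+-mono-≤ y≤x ≤.refl))

  x≤0⇒0≤-x : ∀ {x} → x ≤ 0# → 0# ≤ - x
  x≤0⇒0≤-x {x} x≤0 = +-cancelˡ-≤ x (begin
    x + 0#    ≈⟨ +-identityʳ x ⟩
    x         ≤⟨ x≤0 ⟩
    0#        ≈⟨ -‿inverseʳ x ⟨
    x + (- x) ∎)

  *-monoʳ-≤ : ∀ {a x y} → 0# ≤ a → x ≤ y → a * x ≤ a * y
  *-monoʳ-≤ {a} {x} {y} 0≤a x≤y = begin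
    a * x                     ≤⟨ x≤x+y (*-nonNeg 0≤a 0≤y-x) ⟩
    a * x + a * (- x + y)     ≈⟨ distribˡ a x (- x + y) ⟨
    a * (x + (- x + y))       ≈⟨ *-congˡ (+-assoc x (- x) y) ⟨
    a * (x + (- x) + y)       ≈⟨ *-congˡ (+-congʳ (-‿inverseʳ x)) ⟩
    a * (0# + y)              ≈⟨ *-congˡ (+-identityˡ y) ⟩
    a * y                     ∎
    where
    0≤y-x : 0# ≤ - x + y
    0≤y-x = ≤.trans (≤.reflexive (sym (-‿inverseˡ x))) (+-monoʳ-≤ (- x) x≤y)

  -- If 1 were at most 0, then -1 would be nonnegative, and so would its square, which is 1.
  0≤1 : 0# ≤ 1#
  0≤1 with ≤.total 0# 1#
  ... | inj₁ 0≤1 = 0≤1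
  ... | inj₂ 1≤0 = begin
    0#             ≤⟨ *-nonNeg (x≤0⇒0≤-x 1≤0) (x≤0⇒0≤-x 1≤0) ⟩
    - 1# * - 1#    ≈⟨ -‿distribˡ-* 1# (- 1#) ⟨
    - (1# * - 1#)  ≈⟨ -‿cong (*-identityˡ (- 1#)) ⟩
    - - 1#         ≈⟨ ⁻¹-involutive 1# ⟩
    1#             ∎

  1≰0 : ¬ 1# ≤ 0#
  1≰0 1≤0 = 0≉1 (≤.antisym 0≤1 1≤0)

  ·-nonNeg : ∀ a {x} → 0# ≤ x → 0# ≤ a · x
  ·-nonNeg zero    0≤x = ≤.refl
  ·-nonNeg (suc a) 0≤x = +-nonNeg 0≤x (·-nonNeg a 0≤x)

  ·-monoʳ-≤ : ∀ a {x y} → x ≤ y → a · x ≤ a · y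
  ·-monoʳ-≤ zero    x≤y = ≤.refl
  ·-monoʳ-≤ (suc a) x≤y = +-mono-≤ x≤y (·-monoʳ-≤ a x≤y)

  sum-mono-≤ : ∀ {n} {x y : Vector Carrier n} → (∀ i → x i ≤ y i) → sum x ≤ sum y
  sum-mono-≤ {zero}  x≤y = ≤.refl
  sum-mono-≤ {suc n} x≤y = +-mono-≤ (x≤y zero) (sum-mono-≤ (x≤y ∘ suc))

  sum-nonNeg : ∀ {n} {x : Vector Carrier n} → (∀ i → 0# ≤ x i) → 0# ≤ sum x
  sum-nonNeg {zero}  0≤x = ≤.refl
  sum-nonNeg {suc n} 0≤x = +-nonNeg (0≤x zero) (sum-nonNeg (0≤x ∘ suc))

  1≤fromℕ-suc : ∀ a → 1# ≤ fromℕ (suc a)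
  1≤fromℕ-suc a = x≤x+y (·-nonNeg a 0≤1)

  -- Ordered fields have characteristic 0, so `2k` and `n` are invertible.
  fromℕ-suc≉0 : ∀ a → ¬ fromℕ (suc a) ≈ 0#
  fromℕ-suc≉0 a eq = 1≰0 (≤.trans (1≤fromℕ-suc a) (≤.reflexive eq))

  fromℕ-* : ∀ a x → fromℕ a * x ≈ a · x
  fromℕ-* a x = trans (×-assoc-* a 1# x) (×-congʳ a (*-identityˡ x))

  -- Integral points of the unit cube.

  Binary : ∀ {n} → Vector Carrier n → Set ℓ₁
  Binary x = ∀ i → x i ≈ 0# ⊎ x i ≈ 1#

  -- An integer from 2 on breaks the upper bound and a negative one the lower bound; either way
  -- `1# ≤ 0#` would follow.
  integral⇒binary : ∀ {x} z → x ≈ fromℤ z → 0# ≤ x → x ≤ 1# → x ≈ 0# ⊎ x ≈ 1#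
  integral⇒binary (+ zero)          x≈z 0≤x x≤1 = inj₁ x≈z
  integral⇒binary (+ suc zero)      x≈z 0≤x x≤1 = inj₂ (trans x≈z (+-identityʳ 1#))
  integral⇒binary {x} (+ suc (suc a)) x≈z 0≤x x≤1 = contradiction (+-cancelˡ-≤ 1# (begin
    1# + 1#            ≤⟨ +-monoʳ-≤ 1# (1≤fromℕ-suc a) ⟩
    1# + fromℕ (suc a) ≈⟨ x≈z ⟨
    x                  ≤⟨ x≤1 ⟩
    1#                 ≈⟨ +-identityʳ 1# ⟨
    1# + 0#            ∎)) 1≰0
  integral⇒binary {x} -[1+ a ] x≈z 0≤x x≤1 = contradiction (begin
    1#                                    ≤⟨ 1≤fromℕ-suc a ⟩
    fromℕ (suc a)                         ≈⟨ +-identityʳ _ ⟨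
    fromℕ (suc a) + 0#                    ≤⟨ +-monoʳ-≤ _ 0≤x ⟩
    fromℕ (suc a) + x                     ≈⟨ +-congˡ x≈z ⟩
    fromℕ (suc a) + (- fromℕ (suc a))     ≈⟨ -‿inverseʳ _ ⟩
    0#                                    ∎) 1≰0

  binary-nonNeg : ∀ {x} → x ≈ 0# ⊎ x ≈ 1# → 0# ≤ x
  binary-nonNeg (inj₁ x≈0) = ≤.reflexive (sym x≈0)
  binary-nonNeg (inj₂ x≈1) = ≤.trans 0≤1 (≤.reflexive (sym x≈1))

  -- A leading 1 is split off and the tail treated by induction. After a leading 0 all remaining
  -- entries are 1, and there are exactly as many of them as required.
  one-zero⇒sum : ∀ {N} (x : Vector Carrier (suc N)) → Binary x →
                 (∀ {a b} → a Fin.< b → ¬ (x a ≈ 0# × x b ≈ 0#)) → fromℕ N ≤ sum x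
  one-zero⇒sum {zero}  x bin _ = sum-nonNeg (binary-nonNeg ∘ bin)
  one-zero⇒sum {suc N} x bin unique with bin zero
  ... | inj₂ x₀≈1 = +-mono-≤ (≤.reflexive (sym x₀≈1))
        (one-zero⇒sum (tail x) (bin ∘ suc) (unique ∘ s≤s))
  ... | inj₁ x₀≈0 = begin
    fromℕ (suc N)               ≈⟨ sum-replicate (suc N) ⟨
    sum (replicate (suc N) 1#)  ≈⟨ sum-cong-≋ (λ i → sym (rest i)) ⟩
    sum (tail x)                ≤⟨ x≤y+x (binary-nonNeg (bin zero)) ⟩
    sum x                       ∎
    where
    rest : ∀ i → x (suc i) ≈ 1#
    rest i with bin (suc i)
    ... | inj₁ eq = contradiction (x₀≈0 , eq) (unique (s≤s ℕ.z≤n))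
    ... | inj₂ eq = eq

  -- Weights of cuts.

  mask : Bool → Carrier → Carrier
  mask b x = if b then x else 0#

  mask-mono-≤ : ∀ b {x y} → x ≤ y → mask b x ≤ mask b y
  mask-mono-≤ true  x≤y = x≤y
  mask-mono-≤ false x≤y = ≤.refl

  mask-nonNeg : ∀ b {x} → 0# ≤ x → 0# ≤ mask b x
  mask-nonNeg true  0≤x = 0≤x
  mask-nonNeg false 0≤x = ≤.refl

  mask-≡ : ∀ {a b} x → a ≡ b → mask a x ≈ mask b x
  mask-≡ x ≡.refl = refl

  mask-xor : ∀ a b {x} → 0# ≤ x → mask (a xor b) x ≤ mask a x + mask b x
  mask-xor false b     0≤x = ≤.reflexive (sym (+-identityˡ _))
  mask-xor true  false 0≤x = ≤.reflexive (sym (+-identityʳ _))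
  mask-xor true  true  0≤x = +-nonNeg 0≤x 0≤x

  mask-triangle : ∀ a b d {x} → 0# ≤ x → mask (a xor d) x ≤ mask (a xor b) x + mask (b xor d) x
  mask-triangle a b d {x} 0≤x = begin
    mask (a xor d) x                   ≈⟨ mask-≡ x (xor-telescope a b d) ⟨
    mask ((a xor b) xor (b xor d)) x   ≤⟨ mask-xor (a xor b) (b xor d) 0≤x ⟩
    mask (a xor b) x + mask (b xor d) x ∎

  -- On a closed tour through three labels the number of changes is even and at most three. It is
  -- positive because `a` and `b` differ, so it is two.
  mask-round-trip : ∀ a b d x → a xor b ≡ true →
    mask (a xor d) x + (mask (a xor b) x + mask (b xor d) x) ≈ x + x
  mask-round-trip false true  false x _ = +-identityˡ _
  mask-round-trip false true  true  x _ = +-congˡ (+-identityʳ x)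
  mask-round-trip true  false false x _ = +-congˡ (+-identityʳ x)
  mask-round-trip true  false true  x _ = +-identityˡ _

  sum-indicator : ∀ {n} (u : Fin n) x → (sum λ v → mask (does (v Fin.≟ u)) x) ≈ x
  sum-indicator {suc n} zero x = begin-equality
    x + sum (replicate n 0#) ≈⟨ +-congˡ (sum-replicate-zero n) ⟩
    x + 0#                   ≈⟨ +-identityʳ x ⟩
    x                        ∎
  sum-indicator {suc n} (suc u) x = trans (+-identityˡ _) (sum-indicator u x)

  -- This is x(δ(R)) with `R` given as a labelling, so that cuts can be built and compared
  -- pointwise.
  cut : ∀ {n} (G : Graph n) → (Fin n → Bool) → Vector Carrier (Graph.m G) → Carrier
  cut G r x = sum λ e → mask (crosses G r e) (x e)

  cut-≗ : ∀ {n} (G : Graph n) {r s} x → (∀ v → r v ≡ s v) → cut G r x ≈ cut G s x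
  cut-≗ G x r≗s = sum-cong-≋ λ e → mask-≡ (x e) (≡.cong₂ _xor_ (r≗s _) (r≗s _))

  -- Double counting: after exchanging the sums, each edge is seen from exactly its two end
  -- vertices, which are distinct.
  handshake : ∀ {n} (G : Graph n) x →
    (sum λ v → cut G (singleton v) x) ≈ sum x + sum x
  handshake {n} G x = begin-equality
    (sum λ v → cut G (singleton v) x)
      ≈⟨ ∑-comm (λ v e → mask (crosses G (singleton v) e) (x e)) ⟩
    (sum λ e → sum λ v → mask (crosses G (singleton v) e) (x e))
      ≈⟨ sum-cong-≋ twice ⟩
    (sum λ e → x e + x e)
      ≈⟨ ∑-distrib-+ x x ⟩
    sum x + sum x ∎
    where
    split : ∀ v {u w} y → u ≢ w → mask (does (v Fin.≟ u) xor does (v Fin.≟ w)) y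
                                   ≈ mask (does (v Fin.≟ u)) y + mask (does (v Fin.≟ w)) y
    split v {u} {w} y u≢w with v Fin.≟ u | v Fin.≟ w
    ... | yes v≡u | yes v≡w = contradiction (≡.trans (≡.sym v≡u) v≡w) u≢w
    ... | yes _   | no  _   = sym (+-identityʳ y)
    ... | no  _   | yes _   = sym (+-identityˡ y)
    ... | no  _   | no  _   = sym (+-identityˡ 0#)

    twice : ∀ e → (sum λ v → mask (crosses G (singleton v) e) (x e)) ≈ x e + x e
    twice e = begin-equality
      (sum λ v → mask (crosses G (singleton v) e) (x e))
        ≈⟨ sum-cong-≋ (λ v → split v (x e) (Fin.<⇒≢ (Graph.ordered G e))) ⟩
      (sum λ v → mask (does (v Fin.≟ a)) (x e) + mask (does (v Fin.≟ b)) (x e))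
        ≈⟨ ∑-distrib-+ {n} _ _ ⟩
      (sum λ v → mask (does (v Fin.≟ a)) (x e)) + (sum λ v → mask (does (v Fin.≟ b)) (x e))
        ≈⟨ +-cong (sum-indicator a (x e)) (sum-indicator b (x e)) ⟩
      x e + x e ∎
      where
      a b : Fin n
      a = proj₁ (Graph.ends G e)
      b = proj₂ (Graph.ends G e)

  -- The instance with equal tiers and its constraints.

  uniform : ∀ {n} k → Graph n → Instance F k n
  uniform k G = record
    { graph       = G
    ; cost        = λ _ → 1#
    ; cost-nonNeg = λ _ → 0≤1
    ; T           = λ _ → ⊤
    ; T-mono      = λ _ e∈⊤ → e∈⊤
    ; T-last      = λ _ _ → ≡.refl
    ; q           = λ _ → 1
    ; q-mono      = λ _ → ℕ.≤-refl
    }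

  module _ {n} (k : ℕ) (G : Graph n) where
    open Graph G using (m; δ)
    open MonoidSum ℕ.*-1-monoid using ()
      renaming (sum to product; sum-cong-≗ to product-cong; sum-replicate-zero to product-ones)

    private
      I : Instance F (suc k) n
      I = uniform (suc k) G

    weight-δ : ∀ x R → weight F I x ((δ R ∩ ⊤) ─ ⊥) ≈ cut G (lookup R) x
    weight-δ x R = sum-cong-≋ λ e → mask-≡ (x e) (≡.trans
      (≡.cong (λ A → lookup A e) (≡.trans (Subset.p─⊥≡p _) (Subset.∩-identityʳ (δ R))))
      (lookup-δ G R e))

    residual-⊥ : ∀ j → residual F I ⊥ j ≡ 1
    residual-⊥ j = ≡.cong (1 ℕ.∸_)
      (≡.trans (≡.cong ∣_∣ (Subset.∩-identityʳ (⊥ {m}))) (Subset.∣⊥∣≡0 m))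

    residual-nonempty : ∀ {J} → Nonempty J → ∀ j → residual F I J j ≡ 0
    -- `J` has at least one element because removing `e` makes it strictly smaller; that one element
    -- already meets the requirement 1.
    residual-nonempty {J} (e , e∈J) j = ℕ.m≤n⇒m∸n≡0 (≡.subst (1 ℕ.≤_)
      (≡.cong ∣_∣ (≡.sym (Subset.∩-identityʳ J))) (ℕ.≤-trans (s≤s ℕ.z≤n) (Subset.x∈p⇒∣p-x∣<∣p∣ e∈J)))

    -- With `suc k` tiers the product has a first factor, and its vanishing is enough.
    product-residual-nonempty : ∀ {J} → Nonempty J → product (residual F I J) ≡ 0
    product-residual-nonempty {J} J≢∅ = ≡.cong (ℕ._* product (tail (residual F I J))) (residual-nonempty J≢∅ zero)

    product-residual-⊥ : product (residual F I ⊥) ≡ 1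
    product-residual-⊥ = ≡.trans (product-cong residual-⊥) (product-ones (suc k))

    coefficient-⊥ : ∀ i → coefficient F I ⊥ i ≡ 1
    coefficient-⊥ i = ≡.trans (product-cong factor) (product-ones (suc k))
      where
      factor : ∀ j → (if does (j Fin.≟ i) then 1 else residual F I ⊥ j) ≡ 1
      factor j with does (j Fin.≟ i)
      ... | true  = ≡.refl
      ... | false = residual-⊥ j

    -- Each tier is the full edge set and has coefficient 1, so the cut is counted once per tier.
    lhs-⊥ : ∀ x R → (sum λ i → coefficient F I ⊥ i · weight F I x ((δ R ∩ ⊤) ─ ⊥))
                    ≈ suc k · cut G (lookup R) x
    lhs-⊥ x R = begin-equality
      (sum λ i → coefficient F I ⊥ i · weight F I x ((δ R ∩ ⊤) ─ ⊥))
        ≈⟨ sum-cong-≋ term ⟩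
      sum (replicate (suc k) (cut G (lookup R) x))
        ≈⟨ sum-replicate (suc k) ⟩
      suc k · cut G (lookup R) x ∎
      where
      term : ∀ i → coefficient F I ⊥ i · weight F I x ((δ R ∩ ⊤) ─ ⊥) ≈ cut G (lookup R) x
      term i rewrite coefficient-⊥ i = trans (+-identityʳ _) (weight-δ x R)

    rhs-⊥ : fromℕ (product (residual F I ⊥)) ≈ 1#
    rhs-⊥ rewrite product-residual-⊥ = +-identityʳ 1#

    -- For nonempty `J` the right-hand side is 0 and the left-hand side is nonnegative, so only the
    -- constraints with `J` empty have to be checked.
    lpFeasible⁺ : ∀ {x} → (∀ r → NonConstant r → 1# ≤ suc k · cut G r x) →
                  (∀ e → 0# ≤ x e × x e ≤ 1#) → LPFeasible F I x
    lpFeasible⁺ {x} cuts bounds = constraint , bounds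
      where
      weight-nonNeg : ∀ A → 0# ≤ weight F I x A
      weight-nonNeg A = sum-nonNeg λ e → mask-nonNeg (lookup A e) (proj₁ (bounds e))

      constraint : ∀ J R → Nonempty R → _ → _ → CutConstraint F I x J R
      constraint J R (u , u∈R) (_ , v , _ , v∉R) _ with Subset.nonempty? J
      ... | yes J≢∅ = begin
        fromℕ (product (residual F I J)) ≡⟨ ≡.cong fromℕ (product-residual-nonempty J≢∅) ⟩
        0#                               ≤⟨ sum-nonNeg (λ i → ·-nonNeg (coefficient F I J i) (weight-nonNeg ((δ R ∩ ⊤) ─ J))) ⟩
        (sum λ i → coefficient F I J i · weight F I x ((δ R ∩ ⊤) ─ J)) ∎
      ... | no  J≡∅ rewrite Subset.Empty-unique J≡∅ = begin
        fromℕ (product (residual F I ⊥))  ≈⟨ rhs-⊥ ⟩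
        1#                                ≤⟨ cuts (lookup R) (u , v , uv) ⟩
        suc k · cut G (lookup R) x        ≈⟨ lhs-⊥ x R ⟨
        (sum λ i → coefficient F I ⊥ i · weight F I x ((δ R ∩ ⊤) ─ ⊥)) ∎
        where
        uv : lookup R u xor lookup R v ≡ true
        uv = ≡.cong₂ _xor_ (Vec.[]=⇒lookup u∈R) (Bool.¬-not (v∉R ∘ Vec.lookup⇒[]= v R))

    -- The constraint is taken at `J = ⊥` and the set tabulated from `r`; orienting the witnesses of
    -- nonconstancy yields a member and a nonmember.
    lpFeasible⁻ : ∀ {x} → LPFeasible F I x → ∀ r → NonConstant r → 1# ≤ suc k · cut G r x
    lpFeasible⁻ {x} (constraint , _) r nc = begin
      1#                               ≈⟨ rhs-⊥ ⟨
      fromℕ (product (residual F I ⊥)) ≤⟨ constraint ⊥ R nonempty proper (λ e∈⊥ → contradiction e∈⊥ Subset.∉⊥) ⟩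
      (sum λ i → coefficient F I ⊥ i · weight F I x ((δ R ∩ ⊤) ─ ⊥)) ≈⟨ lhs-⊥ x R ⟩
      suc k · cut G (lookup R) x       ≈⟨ ×-congʳ (suc k) (cut-≗ G x (Vec.lookup∘tabulate r)) ⟩
      suc k · cut G r x                ∎
      where
      R : Subset n
      R = tabulate r

      in-R : ∀ {w} → r w ≡ true → w ∈ R
      in-R {w} eq = Vec.lookup⇒[]= w R (≡.trans (Vec.lookup∘tabulate r w) eq)

      not-in-R : ∀ {w} → r w ≡ false → w ∉ R
      not-in-R {w} eq w∈R with () ← ≡.trans (≡.sym eq)
        (≡.trans (≡.sym (Vec.lookup∘tabulate r w)) (Vec.[]=⇒lookup w∈R))

      nonempty : Nonempty R
      nonempty = _ , in-R (proj₁ (proj₂ (proj₂ (oriented r nc))))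

      proper : R ⊂ ⊤
      proper = Subset.⊆⊤ , _ , Subset.∈⊤ , not-in-R (proj₂ (proj₂ (proj₂ (oriented r nc))))

    totalCost-uniform : ∀ x → totalCost F I x ≈ sum x
    totalCost-uniform x = sum-cong-≋ λ e → *-identityˡ (x e)

  -- Graphs that share the cut properties of a cycle.

  -- The optima are attained at spread h with h = 1/(2k) and at tree.
  record CycleLike {n} (G : Graph (suc n)) : Set (c ⊔ ℓ₁ ⊔ ℓ₂) where
    open Graph G using (m)
    field
      spread      : Carrier → Vector Carrier m
      spread-≥0   : ∀ {h} → 0# ≤ h → ∀ e → 0# ≤ spread h e
      spread-≤    : ∀ {h} → 0# ≤ h → ∀ e → spread h e ≤ h + h
      spread-cut  : ∀ {h} → 0# ≤ h → ∀ r → NonConstant r → h + h ≤ cut G r (spread h)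
      spread-sum  : ∀ h → sum (spread h) ≈ suc n · h
      tree        : Vector Carrier m
      tree-binary : Binary tree
      tree-cut    : ∀ r → NonConstant r → 1# ≤ cut G r tree
      tree-sum    : sum tree ≈ fromℕ n
      binary-sum  : ∀ x → Binary x → (∀ r → NonConstant r → ¬ cut G r x ≤ 0#) → fromℕ n ≤ sum x

  edge-cut : ∀ r → NonConstant r → ∀ x → cut edge r x ≈ x zero
  edge-cut r nc x with nonConstant-from r zero nc
  ... | zero     , eq = contradiction (≡.trans (≡.sym (Bool.xor-same (r zero))) eq) λ ()
  ... | suc zero , eq = trans (+-identityʳ _) (mask-≡ (x zero) eq)

  edge-cycleLike : CycleLike edge
  edge-cycleLike = record
    -- A cycle on two vertices would have two parallel edges; they are merged into one, which
    -- carries both shares `h`.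
    { spread      = λ h _ → h + h
    ; spread-≥0   = λ 0≤h _ → +-nonNeg 0≤h 0≤h
    ; spread-≤    = λ _ _ → ≤.refl
    ; spread-cut  = λ {h} _ r nc → ≤.reflexive (sym (edge-cut r nc (λ _ → h + h)))
    ; spread-sum  = λ h → +-assoc h h 0#
    ; tree        = λ _ → 1#
    ; tree-binary = λ _ → inj₂ refl
    ; tree-cut    = λ r nc → ≤.reflexive (sym (edge-cut r nc (λ _ → 1#)))
    ; tree-sum    = refl
    ; binary-sum  = binary-sum
    }
    where
    r₀ : Fin 2 → Bool
    r₀ = initial zero

    nc : NonConstant r₀
    nc = zero , suc zero , ≡.refl

    binary-sum : ∀ x → Binary x → (∀ r → NonConstant r → ¬ cut edge r x ≤ 0#) → fromℕ 1 ≤ sum x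
    binary-sum x bin pos with bin zero
    ... | inj₁ x≈0 = contradiction (≤.reflexive (trans (edge-cut r₀ nc x) x≈0)) (pos r₀ nc)
    ... | inj₂ x≈1 = ≤.reflexive (+-congʳ (sym x≈1))

  -- Cuts of the path and of the cycle.

  -- The cut weight of the cycle unfolds to the term of the closing edge plus `pathCut r (tail x)`.
  pathCut : ∀ {N} → (Fin (suc N) → Bool) → Vector Carrier N → Carrier
  pathCut r x = sum λ i → mask (r (inject₁ i) xor r (suc i)) (x i)

  -- The triangle inequality is iterated along the path: a change of label between the ends must
  -- occur on some edge.
  pathCut-ends : ∀ {N} r (x : Vector Carrier N) {h} → 0# ≤ h → (∀ i → h ≤ x i) →
                 mask (r zero xor r (Fin.fromℕ N)) h ≤ pathCut r x
  pathCut-ends {zero}  r x {h} 0≤h h≤x = ≤.reflexive (mask-≡ h (Bool.xor-same (r zero)))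
  pathCut-ends {suc N} r x {h} 0≤h h≤x = begin
    mask (r zero xor r (Fin.fromℕ (suc N))) h
      ≤⟨ mask-triangle (r zero) (r (suc zero)) _ 0≤h ⟩
    mask (r zero xor r (suc zero)) h + mask (r (suc zero) xor r (Fin.fromℕ (suc N))) h
      ≤⟨ +-mono-≤ (mask-mono-≤ (r zero xor r (suc zero)) (h≤x zero)) (pathCut-ends (r ∘ suc) (tail x) 0≤h (h≤x ∘ suc)) ⟩
    pathCut r x ∎

  -- The stretches before and after `v` consist of different edges, so their bounds add up. The
  -- induction consumes the first stretch until `v` is the start, where `pathCut-ends` bounds the
  -- second.
  pathCut-via : ∀ {N} r (x : Vector Carrier N) {h} → 0# ≤ h → (∀ i → h ≤ x i) → ∀ v →
                mask (r zero xor r v) h + mask (r v xor r (Fin.fromℕ N)) h ≤ pathCut r x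
  pathCut-via {N} r x {h} 0≤h h≤x zero = begin
    mask (r zero xor r zero) h + mask (r zero xor r (Fin.fromℕ N)) h
      ≈⟨ +-congʳ (mask-≡ h (Bool.xor-same (r zero))) ⟩
    0# + mask (r zero xor r (Fin.fromℕ N)) h
      ≈⟨ +-identityˡ _ ⟩
    mask (r zero xor r (Fin.fromℕ N)) h
      ≤⟨ pathCut-ends r x 0≤h h≤x ⟩
    pathCut r x ∎
  pathCut-via {suc N} r x {h} 0≤h h≤x (suc v) = begin
    mask (r zero xor r (suc v)) h + mask (r (suc v) xor r last) h
      ≤⟨ +-mono-≤ (mask-triangle (r zero) (r (suc zero)) (r (suc v)) 0≤h) ≤.refl ⟩
    mask (r zero xor r (suc zero)) h + mask (r (suc zero) xor r (suc v)) h + mask (r (suc v) xor r last) h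
      ≈⟨ +-assoc _ _ _ ⟩
    mask (r zero xor r (suc zero)) h + (mask (r (suc zero) xor r (suc v)) h + mask (r (suc v) xor r last) h)
      ≤⟨ +-mono-≤ (mask-mono-≤ (r zero xor r (suc zero)) (h≤x zero)) (pathCut-via (r ∘ suc) (tail x) 0≤h (h≤x ∘ suc) v) ⟩
    pathCut r x ∎
    where
    last : Fin (suc (suc N))
    last = Fin.fromℕ (suc N)

  pathCut-initial : ∀ {N} (a : Fin N) x → pathCut (initial a) x ≈ x a
  pathCut-initial {suc N} zero    x = trans (+-congˡ (sum-replicate-zero N)) (+-identityʳ _)
  pathCut-initial {suc N} (suc a) x = trans (+-identityˡ _) (pathCut-initial a (tail x))

  -- The edges crossing a symmetric difference form the symmetric difference of the two sets of
  -- crossing edges.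
  pathCut-xor : ∀ {N} r s {x : Vector Carrier N} → (∀ i → 0# ≤ x i) →
                pathCut (λ v → r v xor s v) x ≤ pathCut r x + pathCut s x
  pathCut-xor {N} r s {x} 0≤x = begin
    pathCut (λ v → r v xor s v) x
      ≤⟨ sum-mono-≤ (λ i → ≤.trans
           (≤.reflexive (mask-≡ (x i) (xor-interchange (r (inject₁ i)) (s (inject₁ i)) _ _)))
           (mask-xor (r (inject₁ i) xor r (suc i)) (s (inject₁ i) xor s (suc i)) (0≤x i))) ⟩
    (sum λ i → mask (r (inject₁ i) xor r (suc i)) (x i) + mask (s (inject₁ i) xor s (suc i)) (x i))
      ≈⟨ ∑-distrib-+ {N} _ _ ⟩
    pathCut r x + pathCut s x ∎

  cycle-cycleLike : ∀ p → CycleLike (cycle p)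
  cycle-cycleLike p = record
    { spread      = λ h _ → h
    ; spread-≥0   = λ 0≤h _ → 0≤h
    ; spread-≤    = λ 0≤h _ → x≤x+y 0≤h
    ; spread-cut  = spread-cut
    ; spread-sum  = λ _ → sum-replicate (suc N)
    ; tree        = tree
    ; tree-binary = λ { zero → inj₁ refl ; (suc _) → inj₂ refl }
    ; tree-cut    = tree-cut
    ; tree-sum    = trans (+-identityˡ _) (sum-replicate N)
    ; binary-sum  = λ x bin pos → one-zero⇒sum x bin (two-zeros x (binary-nonNeg ∘ bin) pos)
    }
    where
    N : ℕ
    N = suc (suc p)

    last : Fin (suc N)
    last = Fin.fromℕ N

    spread-cut : ∀ {h} → 0# ≤ h → ∀ r → NonConstant r → h + h ≤ cut (cycle p) r (λ _ → h)
    spread-cut {h} 0≤h r nc with nonConstant-from r zero nc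
    -- The tour from vertex 0 through `v` to the last vertex and back over the closing edge changes
    -- label exactly twice.
    ... | v , 0v = begin
      h + h
        ≈⟨ mask-round-trip (r zero) (r v) (r last) h 0v ⟨
      mask (r zero xor r last) h + (mask (r zero xor r v) h + mask (r v xor r last) h)
        ≤⟨ +-monoʳ-≤ _ (pathCut-via r (λ _ → h) 0≤h (λ _ → ≤.refl) v) ⟩
      cut (cycle p) r (λ _ → h) ∎

    -- The spanning path left after deleting the closing edge.
    tree : Vector Carrier (suc N)
    tree zero    = 0#
    tree (suc _) = 1#

    tree-cut : ∀ r → NonConstant r → 1# ≤ cut (cycle p) r tree
    tree-cut r nc with nonConstant-from r zero nc
    ... | v , 0v = begin
      1#
        ≈⟨ mask-≡ 1# 0v ⟨
      mask (r zero xor r v) 1#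
        ≤⟨ x≤x+y (mask-nonNeg (r v xor r last) 0≤1) ⟩
      mask (r zero xor r v) 1# + mask (r v xor r last) 1#
        ≤⟨ pathCut-via r (tail tree) 0≤1 (λ _ → ≤.refl) v ⟩
      pathCut r (tail tree)
        ≤⟨ x≤y+x (mask-nonNeg (r zero xor r last) ≤.refl) ⟩
      cut (cycle p) r tree ∎

    -- Any two edges of a cycle are the whole edge set of some cut; if `x` vanished on both, that
    -- cut would have weight 0, against `pos`.
    two-zeros : ∀ x → (∀ e → 0# ≤ x e) → (∀ r → NonConstant r → ¬ cut (cycle p) r x ≤ 0#) →
                ∀ {a b} → a Fin.< b → ¬ (x a ≈ 0# × x b ≈ 0#)
    two-zeros x 0≤x pos {zero} {suc j} _ (x₀≈0 , xⱼ≈0) =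
      -- The initial segment ending at `j` is left only by the closing edge and by path edge `j`.
      pos (initial j) (zero , last , crossing) (begin
        mask (true xor initial j last) (x zero) + pathCut (initial j) (tail x)
          ≈⟨ +-cong (mask-≡ (x zero) crossing) (pathCut-initial j (tail x)) ⟩
        x zero + x (suc j)
          ≈⟨ +-cong x₀≈0 xⱼ≈0 ⟩
        0# + 0#
          ≈⟨ +-identityʳ 0# ⟩
        0# ∎)
      where
      crossing : true xor initial j last ≡ true
      crossing = ≡.cong (true xor_) (initial-last j)
    two-zeros x 0≤x pos {suc i} {suc j} (s≤s i<j) (xᵢ≈0 , xⱼ≈0) =
      -- `r` marks the vertices from `i + 1` to `j`. It contains neither vertex 0 nor the last
      -- vertex, so the closing edge does not cross.
      pos r (zero , suc i , ≡.cong₂ _xor_ (initial-suc i) (initial-< i<j)) (begin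
        mask (r zero xor r last) (x zero) + pathCut r (tail x)
          ≈⟨ +-congʳ (mask-≡ (x zero) (≡.cong₂ _xor_ (initial-last i) (initial-last j))) ⟩
        0# + pathCut r (tail x)
          ≈⟨ +-identityˡ _ ⟩
        pathCut r (tail x)
          ≤⟨ pathCut-xor (initial i) (initial j) (0≤x ∘ suc) ⟩
        pathCut (initial i) (tail x) + pathCut (initial j) (tail x)
          ≈⟨ +-cong (pathCut-initial i (tail x)) (pathCut-initial j (tail x)) ⟩
        x (suc i) + x (suc j)
          ≈⟨ +-cong xᵢ≈0 xⱼ≈0 ⟩
        0# + 0#
          ≈⟨ +-identityʳ 0# ⟩
        0# ∎)
      where
      r : Fin (suc N) → Bool
      r v = initial i v xor initial j v

  -- The two optimum values and their ratio.

  binary⇒integral : ∀ {x} → x ≈ 0# ⊎ x ≈ 1# → ∃[ z ] x ≈ fromℤ z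
  binary⇒integral (inj₁ x≈0) = + 0 , x≈0
  binary⇒integral (inj₂ x≈1) = + 1 , trans x≈1 (sym (+-identityʳ 1#))

  binary-≤1 : ∀ {x} → x ≈ 0# ⊎ x ≈ 1# → x ≤ 1#
  binary-≤1 (inj₁ x≈0) = ≤.trans (≤.reflexive x≈0) 0≤1
  binary-≤1 (inj₂ x≈1) = ≤.reflexive x≈1

  module _ (k n : ℕ) (G : Graph (suc (suc n))) (C : CycleLike G) where
    open Graph G using (m)
    open CycleLike C

    private
      K : ℕ
      K = suc k

      I : Instance F K (suc (suc n))
      I = uniform K G

      h : Carrier
      h = fromℕ (2 ℕ.* K) ⁻¹

    h-inverse : fromℕ (2 ℕ.* K) * h ≈ 1#
    -- `2 ℕ.* K` computes to the successor of `k ℕ.+ (K ℕ.+ 0)`.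
    h-inverse = *-inverseʳ (fromℕ-suc≉0 (k ℕ.+ (K ℕ.+ 0)))

    -- Thus `h + h` is 1/k, the least weight that the constraints with empty `J` allow a cut to
    -- have.
    K·[h+h]≈1 : K · (h + h) ≈ 1#
    K·[h+h]≈1 = begin-equality
      K · (h + h)            ≈⟨ ×-distrib-+ h h K ⟩
      K · h + K · h          ≈⟨ +-congˡ (+-identityʳ _) ⟨
      K · h + (K · h + 0#)   ≈⟨ +-congˡ (×-homo-+ h K 0) ⟨
      K · h + (K ℕ.+ 0) · h  ≈⟨ ×-homo-+ h K (K ℕ.+ 0) ⟨
      (2 ℕ.* K) · h          ≈⟨ fromℕ-* (2 ℕ.* K) h ⟨
      fromℕ (2 ℕ.* K) * h    ≈⟨ h-inverse ⟩
      1#                     ∎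

    0≤h : 0# ≤ h
    0≤h with ≤.total 0# h
    ... | inj₁ 0≤h = 0≤h
    ... | inj₂ h≤0 = contradiction (begin
      1#                   ≈⟨ h-inverse ⟨
      fromℕ (2 ℕ.* K) * h  ≤⟨ *-monoʳ-≤ (·-nonNeg (2 ℕ.* K) 0≤1) h≤0 ⟩
      fromℕ (2 ℕ.* K) * 0# ≈⟨ zeroʳ _ ⟩
      0#                   ∎) 1≰0

    h+h≤y⇒1≤K·y : ∀ {y} → h + h ≤ y → 1# ≤ K · y
    h+h≤y⇒1≤K·y {y} le = begin
      1#          ≈⟨ K·[h+h]≈1 ⟨
      K · (h + h) ≤⟨ ·-monoʳ-≤ K le ⟩
      K · y       ∎

    1≤K·y⇒h+h≤y : ∀ {y} → 1# ≤ K · y → h + h ≤ y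
    1≤K·y⇒h+h≤y {y} le = begin
      h + h             ≈⟨ *-identityʳ (h + h) ⟨
      (h + h) * 1#      ≤⟨ *-monoʳ-≤ (+-nonNeg 0≤h 0≤h) le ⟩
      (h + h) * (K · y) ≈⟨ ×-comm-* K (h + h) y ⟩
      K · ((h + h) * y) ≈⟨ ×-assoc-* K (h + h) y ⟨
      K · (h + h) * y   ≈⟨ *-congʳ K·[h+h]≈1 ⟩
      1# * y            ≈⟨ *-identityˡ y ⟩
      y                 ∎

    h+h≤1 : h + h ≤ 1#
    h+h≤1 = ≤.trans (x≤x+y (·-nonNeg k (+-nonNeg 0≤h 0≤h))) (≤.reflexive K·[h+h]≈1)

    lp : Carrier
    lp = suc (suc n) · h

    ip : Carrier
    ip = fromℕ (suc n)

    0<lp : 0# < lp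
    -- Strictness means `≤` together with `≉`. Since `h` is one summand of `lp`, a vanishing `lp`
    -- would force `h ≤ 0#` and hence `1# ≤ 0#`.
    0<lp = ·-nonNeg (suc (suc n)) 0≤h , λ 0≈lp → 1≰0 (begin
      1#                   ≈⟨ h-inverse ⟨
      fromℕ (2 ℕ.* K) * h  ≤⟨ *-monoʳ-≤ (·-nonNeg (2 ℕ.* K) 0≤1) (x≤x+y (·-nonNeg (suc n) 0≤h)) ⟩
      fromℕ (2 ℕ.* K) * lp ≈⟨ *-congˡ 0≈lp ⟨
      fromℕ (2 ℕ.* K) * 0# ≈⟨ zeroʳ _ ⟩
      0#                   ∎)

    lp-optimum : IsOptimumLP F I lp
    lp-optimum = (spread h , feasible , trans (totalCost-uniform k G (spread h)) (spread-sum h)) , bound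
      where
      feasible : LPFeasible F I (spread h)
      feasible = lpFeasible⁺ k G (λ r nc → h+h≤y⇒1≤K·y (spread-cut 0≤h r nc))
        λ e → spread-≥0 0≤h e , ≤.trans (spread-≤ 0≤h e) h+h≤1

      bound : ∀ x → LPFeasible F I x → lp ≤ totalCost F I x
      -- The single-vertex cuts add up to twice the total weight, so doubled values are compared.
      bound x feas = x+x≤y+y⇒x≤y (begin
        lp + lp
          ≈⟨ ×-distrib-+ h h (suc (suc n)) ⟨
        suc (suc n) · (h + h)
          ≈⟨ sum-replicate (suc (suc n)) ⟨
        sum (replicate (suc (suc n)) (h + h))
          ≤⟨ sum-mono-≤ (λ v → 1≤K·y⇒h+h≤y (lpFeasible⁻ k G feas (singleton v) (singleton-nonConstant v))) ⟩
        (sum λ v → cut G (singleton v) x)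
          ≈⟨ handshake G x ⟩
        sum x + sum x
          ≈⟨ +-cong (totalCost-uniform k G x) (totalCost-uniform k G x) ⟨
        totalCost F I x + totalCost F I x ∎)

    ip-optimum : IsOptimumIP F I ip
    ip-optimum = (tree , feasible , trans (totalCost-uniform k G tree) tree-sum) , bound
      where
      feasible : IPFeasible F I tree
      feasible = lpFeasible⁺ k G
        -- A single one of the `K` copies of the cut weight already reaches 1.
        (λ r nc → ≤.trans (tree-cut r nc) (x≤x+y (·-nonNeg k (≤.trans 0≤1 (tree-cut r nc)))))
        (λ e → binary-nonNeg (tree-binary e) , binary-≤1 (tree-binary e))
        , binary⇒integral ∘ tree-binary

      bound : ∀ x → IPFeasible F I x → ip ≤ totalCost F I x
      bound x (feas@(_ , bounds) , integral) = begin
        ip              ≤⟨ binary-sum x binary positive ⟩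
        sum x           ≈⟨ totalCost-uniform k G x ⟨
        totalCost F I x ∎
        where
        binary : Binary x
        binary e = integral⇒binary (proj₁ (integral e)) (proj₂ (integral e))
          (proj₁ (bounds e)) (proj₂ (bounds e))

        positive : ∀ r → NonConstant r → ¬ cut G r x ≤ 0#
        positive r nc cut≤0 = 1≰0 (begin
          1#                    ≤⟨ lpFeasible⁻ k G feas r nc ⟩
          K · cut G r x         ≤⟨ ·-monoʳ-≤ K cut≤0 ⟩
          K · 0#                ≈⟨ sum-replicate K ⟨
          sum (replicate K 0#)  ≈⟨ sum-replicate-zero K ⟩
          0#                    ∎)

    -- Regrouping pairs `2k` with `h`, giving 1, and `1 - 1/n` with `n`, giving `n - 1`, where `n`
    -- is the number of vertices.
    gap : (fromℕ (2 ℕ.* K) * (1# - fromℕ (suc (suc n)) ⁻¹)) * lp ≈ ip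
    gap = begin-equality
      (A * (1# - b)) * lp        ≈⟨ *-congˡ (fromℕ-* (suc (suc n)) h) ⟨
      (A * (1# - b)) * (B * h)   ≈⟨ *-congˡ (*-comm B h) ⟩
      (A * (1# - b)) * (h * B)   ≈⟨ *-interchange A (1# - b) h B ⟩
      (A * h) * ((1# - b) * B)   ≈⟨ *-congʳ h-inverse ⟩
      1# * ((1# - b) * B)        ≈⟨ *-identityˡ _ ⟩
      (1# - b) * B               ≈⟨ distribʳ B 1# (- b) ⟩
      1# * B + - b * B           ≈⟨ +-cong (*-identityˡ B) (sym (-‿distribˡ-* b B)) ⟩
      B + - (b * B)              ≈⟨ +-congˡ (-‿cong (*-comm b B)) ⟩
      B + - (B * b)              ≈⟨ +-congˡ (-‿cong (*-inverseʳ (fromℕ-suc≉0 (suc n)))) ⟩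
      B + - 1#                   ≈⟨ +-comm B (- 1#) ⟩
      -- `B` unfolds to `1# + ip`.
      - 1# + (1# + ip)           ≈⟨ -x+[x+y]≈y 1# ip ⟩
      ip                         ∎
      where
      A B b : Carrier
      A = fromℕ (2 ℕ.* K)
      B = fromℕ (suc (suc n))
      b = B ⁻¹

  cycleLike-gap : ∀ k n (G : Graph (suc (suc n))) → CycleLike G →
    Σ[ I ∈ Instance F (suc k) (suc (suc n)) ] Σ[ ip ∈ Carrier ] Σ[ lp ∈ Carrier ]
      (IsOptimumIP F I ip × IsOptimumLP F I lp × 0# < lp ×
       (fromℕ (2 ℕ.* suc k) * (1# - fromℕ (suc (suc n)) ⁻¹)) * lp ≤ ip)
  cycleLike-gap k n G C = uniform (suc k) G , ip k n G C , lp k n G C ,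
    ip-optimum k n G C , lp-optimum k n G C , 0<lp k n G C , ≤.reflexive (gap k n G C)

lemma2p14 : ∀ {c ℓ₁ ℓ₂} (F : OrderedField c ℓ₁ ℓ₂) → let open OrderedField F in
    ∀ (k n : ℕ) → 1 ℕ.≤ k → 2 ℕ.≤ n →
    Σ[ I ∈ Instance F k n ] Σ[ ip ∈ Carrier ] Σ[ lp ∈ Carrier ]
    (IsOptimumIP F I ip × IsOptimumLP F I lp × 0# < lp ×
    (fromℕ (2 ℕ.* k) * (1# - fromℕ n ⁻¹)) * lp ≤ ip)
-- The numbers passed on are shifted: `k` is one less than the number of tiers, and the next
-- argument is two less than the number of vertices.
lemma2p14 F (suc k) (suc (suc zero))    _ _ = cycleLike-gap F k 0 edge (edge-cycleLike F)
lemma2p14 F (suc k) (suc (suc (suc p))) _ _ = cycleLike-gap F k (suc p) (cycle p) (cycle-cycleLike F p)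
lemma2p14 F (suc k) (suc zero)          _ (s≤s ())
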